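{- Let $n\ge 4$. Among all spiro hexagonal chains with $n$ hexagons: (i) the unique one with minimum Wiener index is the spiro ortho-chain $O_n$; (ii) the unique one with the second minimal Wiener index is the chain with cut-vertex sequence $(c_2,\dots,c_{n-1})=(o_1,\dots,o_{n-3},m_{n-2})$; (iii) the unique one with the third minimal Wiener index is the chain with cut-vertex sequence $(c_2,\dots,c_{n-1})=(o_1,\dots,o_{n-4},m_{n-3},o_{n-2})$.
   Context: The Wiener index is $W(G)=\sum_{\{u,v\}\subseteq V(G)} d(u,v)$, with $d$ the shortest-path distance. A spiro hexagonal chain with $n$ hexagons is a graph $G_n=H_0H_1\cdots H_{n-1}$ that is the union of hexagons (6-cycles) $H_0,\dots,H_{n-1}$ such that for $1\le k\le n-1$, $H_{k-1}$ and $H_k$ share exactly one vertex $c_k$, the $c_k$ are distinct, and $H_i,H_j$ are disjoint when $|i-j|\ge 2$. For $k\ge 1$, a vertex of $H_k$ at distance $1$, $2$, $3$ from $c_k$ is denoted $o_k$, $m_k$, $p_k$ (ortho-, meta-, para-vertex). The cut-vertex sequence $(c_2,\dots,c_{n-1})$ records, for each $k$, whether $c_k$ is $o_{k-1}$, $m_{k-1}$ or $p_{k-1}$; it determines the chain up to isomorphism, and a sequence and its reversal (in terms of types) determine the same chain. The spiro ortho-chain $O_n$ is the chain with $c_k=o_{k-1}$ for all $2\le k\le n-1$. Chains are considered up to isomorphism. -}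

module Defs where

open import Data.Bool using (Bool; true; false; _∧_; _∨_; if_then_else_)
open import Data.Nat using (ℕ; zero; suc; _+_; _*_; _∸_; _≡ᵇ_)
open import Data.Product using (_×_; _,_; proj₁; proj₂)
open import Data.List using (List; filterᵇ; []; _∷_; length; map; upTo; concatMap; replicate; reverse; _++_)
open import Data.Nat.ListAction using (sum)
open import Data.Bool.ListAction using (any)

record Graph : Set where
  field
    size : ℕ
    adj  : ℕ → ℕ → Bool
open Graph public

vertices : Graph → List ℕ
vertices G = upTo (size G)

expand : Graph → List ℕ → List ℕ
expand G S = filterᵇ (λ v → any (λ w → (w ≡ᵇ v) ∨ adj G w v) S) (vertices G)

ball : Graph → ℕ → ℕ → List ℕ
ball G u zero    = u ∷ []
ball G u (suc k) = expand G (ball G u k)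

reach : Graph → ℕ → ℕ → ℕ → Bool
reach G k u v = any (λ w → w ≡ᵇ v) (ball G u k)

-- Shortest-path distance: the least k such that v is reachable from u by a
-- walk of length ≤ k (search over k = 0, 1, …, size G; for the connected
-- graphs considered here the search always succeeds).
distFrom : Graph → ℕ → ℕ → ℕ → ℕ → ℕ
distFrom G u v k zero    = k
distFrom G u v k (suc f) = if reach G k u v then k else distFrom G u v (suc k) f

dist : Graph → ℕ → ℕ → ℕ
dist G u v = distFrom G u v 0 (size G)

wiener : Graph → ℕ
wiener G =
  sum (map (λ u → sum (map (λ v → dist G u v) (upTo u))) (vertices G))

-- Type of a cut vertex c_k relative to the previous hexagon H_{k-1}:
-- ortho / meta / para (distance 1 / 2 / 3 from c_{k-1} in H_{k-1}).

data Ty : Set where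
  o m p : Ty

offset : Ty → ℕ
offset o = 1
offset m = 2
offset p = 3

-- t s i = type of c_{i+2}, i.e. the i-th entry of the cut-vertex sequence
-- (c_2, …, c_{n-1}) (defaulting to o outside the range, never used).
tyAt : List Ty → ℕ → Ty
tyAt []      _       = o
tyAt (x ∷ _) zero    = x
tyAt (_ ∷ s) (suc i) = tyAt s i

-- Vertex numbering of the chain H_0 H_1 ⋯ H_{n-1} with n = length s + 2:
-- H_0 has vertices 0,…,5 (cycle order); for k ≥ 1, H_k has vertices
-- c_k (position 0) and the new vertices 5k+1, …, 5k+5 (positions 1..5),
-- in cycle order.  c_1 = 0; for k ≥ 2, c_k is the vertex of H_{k-1} at
-- cyclic position 1, 2 or 3 (i.e. distance 1, 2, 3 from c_{k-1}) according
-- to whether c_k is o_{k-1}, m_{k-1}, p_{k-1}.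

cut : List Ty → ℕ → ℕ
cut s zero          = 0   -- unused
cut s (suc zero)    = 0
cut s (suc (suc k)) = 5 * suc k + offset (tyAt s k)

pos : List Ty → ℕ → ℕ → ℕ
pos s zero    j       = j
pos s (suc k) zero    = cut s (suc k)
pos s (suc k) (suc j) = 5 * suc k + suc j

next6 : ℕ → ℕ
next6 5 = 0
next6 j = suc j

hexEdges : List Ty → ℕ → List (ℕ × ℕ)
hexEdges s k = map (λ j → (pos s k j , pos s k (next6 j))) (upTo 6)

hexCount : List Ty → ℕ
hexCount s = length s + 2

chainEdges : List Ty → List (ℕ × ℕ)
chainEdges s = concatMap (hexEdges s) (upTo (hexCount s))

chain : List Ty → Graph
chain s = record
  { size = 5 * hexCount s + 1
  ; adj  = λ u v → any (λ e → ((proj₁ e ≡ᵇ u) ∧ (proj₂ e ≡ᵇ v))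
                             ∨ ((proj₁ e ≡ᵇ v) ∧ (proj₂ e ≡ᵇ u))) (chainEdges s)
  }

orthoSeq : ℕ → List Ty
orthoSeq n = replicate (n ∸ 2) o

secondSeq : ℕ → List Ty
secondSeq n = replicate (n ∸ 3) o ++ (m ∷ [])

thirdSeq : ℕ → List Ty
thirdSeq n = replicate (n ∸ 4) o ++ (m ∷ o ∷ [])

-- Every shortest path between two hexagons of a spiro chain passes through the cut vertices
-- between them, so d(u, v) is the distance from u to the vertex through which paths from u
-- enter the hexagon of v, plus a distance inside that hexagon.  This explicit formula agrees
-- with breadth-first distance because it vanishes only at u, grows by at most one along an
-- edge and drops by one along some edge at every other vertex.  Adding the hexagons one at
-- a time gives W(G_n) = C(n) + 25 Σ_j (j + 1)(n - 2 - j) e_j, where e_j is 0, 1 or 2 according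
-- as c_{j+2} is an ortho, meta or para vertex.  The weights are at least n - 2, smallest at
-- the two ends and next smallest one step in: so O_n is the minimum, a single meta vertex at
-- an end gives the second minimum and one a step inside the third, while a para vertex or
-- two non-ortho vertices already cost at least 2(n - 2).

module Submission where

open import Defs
open import Data.Bool using (Bool; true; false; T; _∧_; _∨_; if_then_else_)
open import Data.Bool.Properties using (T-∨; T-∧; T-≡; T?)
open import Data.Bool.ListAction using (any; all)
open import Data.Empty using (⊥-elim)
open import Data.List using (List; []; _∷_; _∷ʳ_; length; map; upTo; replicate; reverse; _++_)
open import Data.List.Properties
  using (upTo-∷ʳ; map-++; length-++; length-replicate; unfold-reverse; reverse-++; ++-assoc)
open import Data.Nat.ListAction using (sum)
open import Data.Nat.ListAction.Properties using (sum-++)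
open import Data.List.Membership.Propositional using (_∈_; find; lose)
open import Data.List.Membership.Propositional.Properties
  using (∈-filter⁺; ∈-filter⁻; ∈-upTo⁺; ∈-upTo⁻; ∈-map⁺; ∈-map⁻; ∈-concat⁺′; ∈-concat⁻′)
open import Data.List.Relation.Unary.Any using (here)
open import Data.List.Relation.Unary.All as All using ()
open import Data.List.Relation.Unary.All.Properties using (all⁺)
open import Data.List.Relation.Unary.Any.Properties using (any⁺; any⁻)
open import Data.Nat
open import Data.Nat.Properties
open import Data.Nat.Tactic.RingSolver using (solve-∀)
open import Algebra.Properties.CommutativeSemigroup +-commutativeSemigroup using (interchange; xy∙z≈xz∙y)
open import Data.Product as Product using (∃; _×_; _,_; proj₁; proj₂; map₁)
open import Data.Sum as Sum using (_⊎_; inj₁; inj₂)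
open import Function using (_∘_; _$_)
open import Function.Bundles using (Equivalence)
open import Relation.Nullary using (yes; no)
open import Relation.Binary.Definitions using (Tri; tri<; tri≈; tri>)
open import Relation.Binary.PropositionalEquality

-- Breadth-first distance

module BFSLabelling (G : Graph) (u : ℕ) (D : ℕ → ℕ)
  (u∈G : u < size G)
  (D-source : D u ≡ 0)
  (D≡0⇒source : ∀ v → D v ≡ 0 → v ≡ u)
  (D-adj : ∀ w v → T (adj G w v) → D v ≤ suc (D w))
  (D-pred : ∀ v → v < size G → ∀ k → D v ≡ suc k → ∃ λ w → w < size G × T (adj G w v) × D w ≡ k)
  where

  private
    step? : List ℕ → ℕ → Bool
    step? S v = any (λ w → (w ≡ᵇ v) ∨ adj G w v) S

  ∈-ball⁻ : ∀ k {v} → v ∈ ball G u k → v < size G × D v ≤ k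
  ∈-ball⁻ zero (here refl) = u∈G , ≤-reflexive D-source
  ∈-ball⁻ (suc k) {v} v∈ball
    with v∈G , stepped ← ∈-filter⁻ (T? ∘ step? (ball G u k)) {xs = vertices G} v∈ball
    with w , w∈ball , w→v ← find (any⁻ _ (ball G u k) stepped)
    with _ , Dw≤k ← ∈-ball⁻ k w∈ball
    with Equivalence.to T-∨ w→v
  ... | inj₁ w≡v = ∈-upTo⁻ v∈G , subst (λ x → D x ≤ suc k) (≡ᵇ⇒≡ w v w≡v) (m≤n⇒m≤1+n Dw≤k)
  ... | inj₂ w~v = ∈-upTo⁻ v∈G , ≤-trans (D-adj w v w~v) (s≤s Dw≤k)

  ∈-ball⁺ : ∀ k {v} → v < size G → D v ≤ k → v ∈ ball G u k
  ∈-ball⁺ zero {v} _ Dv≤0 rewrite D≡0⇒source v (n≤0⇒n≡0 Dv≤0) = here refl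
  ∈-ball⁺ (suc k) {v} v∈G Dv≤1+k =
    let w , w∈ball , w→v = predecessor in
    ∈-filter⁺ (T? ∘ step? (ball G u k)) (∈-upTo⁺ v∈G) (any⁺ _ (lose w∈ball w→v))
    where
    predecessor : ∃ λ w → w ∈ ball G u k × T ((w ≡ᵇ v) ∨ adj G w v)
    predecessor with m≤n⇒m<n∨m≡n Dv≤1+k
    ... | inj₁ (s≤s Dv≤k) = v , ∈-ball⁺ k v∈G Dv≤k , Equivalence.from T-∨ (inj₁ (≡⇒≡ᵇ v v refl))
    ... | inj₂ Dv≡1+k with w , w∈G , w~v , Dw≡k ← D-pred v v∈G k Dv≡1+k =
      w , ∈-ball⁺ k w∈G (≤-reflexive Dw≡k) , Equivalence.from T-∨ (inj₂ w~v)

  reach⇒≤ : ∀ k v → T (reach G k u v) → D v ≤ k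
  reach⇒≤ k v reached with w , w∈ball , w≡v ← find (any⁻ _ (ball G u k) reached) =
    subst (λ x → D x ≤ k) (≡ᵇ⇒≡ w v w≡v) (proj₂ (∈-ball⁻ k w∈ball))

  ≤⇒reach : ∀ k v → v < size G → D v ≤ k → T (reach G k u v)
  ≤⇒reach k v v∈G Dv≤k = any⁺ _ (lose (∈-ball⁺ k v∈G Dv≤k) (≡⇒≡ᵇ v v refl))

  distFrom≡ : ∀ v → v < size G → ∀ f k → k ≤ D v → D v ≤ k + f → distFrom G u v k f ≡ D v
  distFrom≡ v v∈G zero k k≤Dv Dv≤k+0 = ≤-antisym k≤Dv (subst (D v ≤_) (+-identityʳ k) Dv≤k+0)
  distFrom≡ v v∈G (suc f) k k≤Dv Dv≤k+1+f with reach G k u v in reached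
  ... | true = ≤-antisym k≤Dv (reach⇒≤ k v (subst T (sym reached) _))
  ... | false with m≤n⇒m<n∨m≡n k≤Dv
  ...   | inj₁ k<Dv = distFrom≡ v v∈G f (suc k) k<Dv (subst (D v ≤_) (+-suc k f) Dv≤k+1+f)
  ...   | inj₂ k≡Dv = ⊥-elim (subst T reached (≤⇒reach k v v∈G (≤-reflexive (sym k≡Dv))))

  dist≡ : ∀ v → v < size G → D v ≤ size G → dist G u v ≡ D v
  dist≡ v v∈G = distFrom≡ v v∈G (size G) 0 z≤n

-- Finite sums and moments

sumBelow : ℕ → (ℕ → ℕ) → ℕ
sumBelow zero    f = 0
sumBelow (suc k) f = sumBelow k f + f k

sum-map-upTo : ∀ k f → sum (map f (upTo k)) ≡ sumBelow k f
sum-map-upTo zero    f = refl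
sum-map-upTo (suc k) f = begin
  sum (map f (upTo (suc k)))            ≡⟨ cong (sum ∘ map f) (upTo-∷ʳ k) ⟨
  sum (map f (upTo k ++ k ∷ []))        ≡⟨ cong sum (map-++ f (upTo k) (k ∷ [])) ⟩
  sum (map f (upTo k) ++ f k ∷ [])      ≡⟨ sum-++ (map f (upTo k)) (f k ∷ []) ⟩
  sum (map f (upTo k)) + (f k + 0)      ≡⟨ cong₂ _+_ (sum-map-upTo k f) (+-identityʳ (f k)) ⟩
  sumBelow k f + f k                    ∎
  where open ≡-Reasoning

sumBelow-cong : ∀ k {f g} → (∀ i → i < k → f i ≡ g i) → sumBelow k f ≡ sumBelow k g
sumBelow-cong zero    f≡g = refl
sumBelow-cong (suc k) f≡g =
  cong₂ _+_ (sumBelow-cong k (λ i i<k → f≡g i (m<n⇒m<1+n i<k))) (f≡g k (n<1+n k))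

sumBelow-mono : ∀ k {f g} → (∀ i → f i ≤ g i) → sumBelow k f ≤ sumBelow k g
sumBelow-mono zero    f≤g = z≤n
sumBelow-mono (suc k) f≤g = +-mono-≤ (sumBelow-mono k f≤g) (f≤g k)

sumBelow-+ : ∀ k f g → sumBelow k (λ i → f i + g i) ≡ sumBelow k f + sumBelow k g
sumBelow-+ zero    f g = refl
sumBelow-+ (suc k) f g =
  trans (cong (_+ (f k + g k)) (sumBelow-+ k f g)) (interchange (sumBelow k f) (sumBelow k g) (f k) (g k))

sumBelow-zero : ∀ k {f} → (∀ i → i < k → f i ≡ 0) → sumBelow k f ≡ 0
sumBelow-zero zero    f≡0 = refl
sumBelow-zero (suc k) f≡0 =
  cong₂ _+_ (sumBelow-zero k (λ i i<k → f≡0 i (m<n⇒m<1+n i<k))) (f≡0 k (n<1+n k))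

sumBelow-const : ∀ k c → sumBelow k (λ _ → c) ≡ k * c
sumBelow-const zero    c = refl
sumBelow-const (suc k) c = trans (cong (_+ c) (sumBelow-const k c)) (+-comm (k * c) c)

sumBelow-split : ∀ a b f → sumBelow (a + b) f ≡ sumBelow a f + sumBelow b (λ i → f (a + i))
sumBelow-split a zero    f = trans (cong (λ k → sumBelow k f) (+-identityʳ a)) (sym (+-identityʳ _))
sumBelow-split a (suc b) f = begin
  sumBelow (a + suc b) f                                  ≡⟨ cong (λ k → sumBelow k f) (+-suc a b) ⟩
  sumBelow (a + b) f + f (a + b)                          ≡⟨ cong (_+ f (a + b)) (sumBelow-split a b f) ⟩
  sumBelow a f + sumBelow b (λ i → f (a + i)) + f (a + b) ≡⟨ +-assoc (sumBelow a f) _ _ ⟩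
  sumBelow a f + sumBelow (suc b) (λ i → f (a + i))       ∎
  where open ≡-Reasoning

moment : (ℕ → ℕ) → ℕ → ℕ
moment f k = sumBelow k (λ i → i * f i)

-- moment₂ f k = Σ_{i<k} i (k - 1 - i) f(i)
moment₂ : (ℕ → ℕ) → ℕ → ℕ
moment₂ f k = sumBelow k (moment f)

moment₂-cong : ∀ {f g} → (∀ i → f i ≡ g i) → ∀ k → moment₂ f k ≡ moment₂ g k
moment₂-cong f≡g k = sumBelow-cong k (λ j _ → sumBelow-cong j (λ i _ → cong (i *_) (f≡g i)))

moment₂-mono : ∀ {f g} → (∀ i → f i ≤ g i) → ∀ k → moment₂ f k ≤ moment₂ g k
moment₂-mono f≤g k = sumBelow-mono k (λ j → sumBelow-mono j (λ i → *-monoʳ-≤ i (f≤g i)))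

moment₂-+ : ∀ f g k → moment₂ (λ i → f i + g i) k ≡ moment₂ f k + moment₂ g k
moment₂-+ f g k = begin
  sumBelow k (λ j → sumBelow j (λ i → i * (f i + g i)))
    ≡⟨ sumBelow-cong k (λ j _ →
         sumBelow-cong j (λ i _ → *-distribˡ-+ i (f i) (g i))) ⟩
  sumBelow k (λ j → sumBelow j (λ i → i * f i + i * g i))
    ≡⟨ sumBelow-cong k (λ j _ →
         sumBelow-+ j (λ i → i * f i) (λ i → i * g i)) ⟩
  sumBelow k (λ j → moment f j + moment g j)
    ≡⟨ sumBelow-+ k (moment f) (moment g) ⟩
  moment₂ f k + moment₂ g k ∎
  where open ≡-Reasoning

moment₂-zero : ∀ k → moment₂ (λ _ → 0) k ≡ 0
moment₂-zero k = sumBelow-zero k (λ j _ → sumBelow-zero j (λ i _ → *-zeroʳ i))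

indicator : ℕ → ℕ → ℕ
indicator i x = if x ≡ᵇ i then 1 else 0

indicator-≢ : ∀ i x → x ≢ i → indicator i x ≡ 0
indicator-≢ i x x≢i with x ≡ᵇ i in x≡ᵇi
... | true  = ⊥-elim (x≢i (≡ᵇ⇒≡ x i (subst T (sym x≡ᵇi) _)))
... | false = refl

indicator-≡ : ∀ i → indicator i i ≡ 1
indicator-≡ i rewrite Equivalence.to T-≡ (≡⇒≡ᵇ i i refl) = refl

moment-indicator-below : ∀ i k → k ≤ i → moment (indicator i) k ≡ 0
moment-indicator-below i k k≤i =
  sumBelow-zero k (λ j j<k → trans (cong (j *_) (indicator-≢ i j (<⇒≢ (<-≤-trans j<k k≤i)))) (*-zeroʳ j))

moment-indicator-above : ∀ i g → moment (indicator i) (suc i + g) ≡ i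
moment-indicator-above i zero = begin
  moment (indicator i) (suc i + 0)
    ≡⟨ cong (moment (indicator i)) (+-identityʳ (suc i)) ⟩
  moment (indicator i) i + i * indicator i i
    ≡⟨ cong₂ (λ x y → x + i * y) (moment-indicator-below i i ≤-refl) (indicator-≡ i) ⟩
  i * 1
    ≡⟨ *-identityʳ i ⟩
  i ∎
  where open ≡-Reasoning
moment-indicator-above i (suc g) = begin
  moment (indicator i) (suc i + suc g)
    ≡⟨ cong (moment (indicator i)) (+-suc (suc i) g) ⟩
  moment (indicator i) (suc i + g) + (suc i + g) * indicator i (suc i + g)
    ≡⟨ cong₂ (λ x y → x + (suc i + g) * y) (moment-indicator-above i g)
         (indicator-≢ i (suc i + g) (>⇒≢ (s≤s (m≤m+n i g)))) ⟩
  i + (suc i + g) * 0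
    ≡⟨ cong (i +_) (*-zeroʳ (suc i + g)) ⟩
  i + 0
    ≡⟨ +-identityʳ i ⟩
  i ∎
  where open ≡-Reasoning

moment₂-indicator : ∀ i g → moment₂ (indicator i) (suc i + g) ≡ i * g
moment₂-indicator i zero = begin
  moment₂ (indicator i) (suc i + 0)
    ≡⟨ cong (moment₂ (indicator i)) (+-identityʳ (suc i)) ⟩
  moment₂ (indicator i) (suc i)
    ≡⟨ sumBelow-zero (suc i) (λ j j≤i → moment-indicator-below i j (m<1+n⇒m≤n j≤i)) ⟩
  0
    ≡⟨ *-zeroʳ i ⟨
  i * 0 ∎
  where open ≡-Reasoning
moment₂-indicator i (suc g) = begin
  moment₂ (indicator i) (suc i + suc g)
    ≡⟨ cong (moment₂ (indicator i)) (+-suc (suc i) g) ⟩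
  moment₂ (indicator i) (suc i + g) + moment (indicator i) (suc i + g)
    ≡⟨ cong₂ _+_ (moment₂-indicator i g) (moment-indicator-above i g) ⟩
  i * g + i
    ≡⟨ +-comm (i * g) i ⟩
  i + i * g
    ≡⟨ *-suc i g ⟨
  i * suc g ∎
  where open ≡-Reasoning

-- Distances on a hexagon whose positions are numbered 0, …, 5 in cyclic order.

cycleDist : ℕ → ℕ
cycleDist 0 = 0
cycleDist 1 = 1
cycleDist 2 = 2
cycleDist 3 = 3
cycleDist 4 = 2
cycleDist 5 = 1
cycleDist _ = 0

hexDist : ℕ → ℕ → ℕ
hexDist i j = cycleDist ∣ i - j ∣

prev6 : ℕ → ℕ
prev6 zero    = 5
prev6 (suc j) = j

towards : ℕ → ℕ → ℕ
towards a j = if hexDist a (next6 j) <ᵇ hexDist a j then next6 j else prev6 j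

private
  byComputation : (test : ℕ → Bool) → {T (all test (upTo 6))} → ∀ j → j ≤ 5 → T (test j)
  byComputation test {checked} j j≤5 = All.lookup (all⁺ test (upTo 6) checked) (∈-upTo⁺ (s≤s j≤5))

  byComputation₂ : (test : ℕ → ℕ → Bool) → {T (all (λ i → all (test i) (upTo 6)) (upTo 6))} →
                   ∀ i j → i ≤ 5 → j ≤ 5 → T (test i j)
  byComputation₂ test {checked} i j i≤5 =
    byComputation (test i) {byComputation (λ i → all (test i) (upTo 6)) {checked} i i≤5} j

cycleDist≤3 : ∀ d → cycleDist d ≤ 3
cycleDist≤3 0 = z≤n
cycleDist≤3 1 = s≤s z≤n
cycleDist≤3 2 = s≤s (s≤s z≤n)
cycleDist≤3 3 = ≤-refl
cycleDist≤3 4 = s≤s (s≤s z≤n)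
cycleDist≤3 5 = s≤s z≤n
cycleDist≤3 (suc (suc (suc (suc (suc (suc d)))))) = z≤n

hexDist≤3 : ∀ i j → hexDist i j ≤ 3
hexDist≤3 i j = cycleDist≤3 ∣ i - j ∣

hexDist-self : ∀ x → hexDist x x ≡ 0
hexDist-self x = cong cycleDist (∣n-n∣≡0 x)

hexDist-0ʳ : ∀ x → x ≤ 3 → hexDist x 0 ≡ x
hexDist-0ʳ 0 _ = refl
hexDist-0ʳ 1 _ = refl
hexDist-0ʳ 2 _ = refl
hexDist-0ʳ 3 _ = refl
hexDist-0ʳ (suc (suc (suc (suc _)))) (s≤s (s≤s (s≤s ())))

hexDist-0ˡ : ∀ x → x ≤ 3 → hexDist 0 x ≡ x
hexDist-0ˡ 0 _ = refl
hexDist-0ˡ 1 _ = refl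
hexDist-0ˡ 2 _ = refl
hexDist-0ˡ 3 _ = refl
hexDist-0ˡ (suc (suc (suc (suc _)))) (s≤s (s≤s (s≤s ())))

hexDist≡0⇒≡ : ∀ x y → x ≤ 5 → y ≤ 5 → hexDist x y ≡ 0 → x ≡ y
hexDist≡0⇒≡ x y x≤5 y≤5 d≡0
  with Equivalence.to T-∨ (byComputation₂ (λ x y → (0 <ᵇ hexDist x y) ∨ (x ≡ᵇ y)) x y x≤5 y≤5)
... | inj₁ 0<d = ⊥-elim (<-irrefl (sym d≡0) (<ᵇ⇒< 0 _ 0<d))
... | inj₂ x≡y = ≡ᵇ⇒≡ x y x≡y

next6≤5 : ∀ j → j ≤ 5 → next6 j ≤ 5
next6≤5 j j≤5 = ≤ᵇ⇒≤ (next6 j) 5 (byComputation (λ j → next6 j ≤ᵇ 5) j j≤5)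

hexDist-next≤ : ∀ a j → a ≤ 5 → j ≤ 5 → hexDist a (next6 j) ≤ suc (hexDist a j)
hexDist-next≤ a j a≤5 j≤5 =
  ≤ᵇ⇒≤ _ _ (byComputation₂ (λ a j → hexDist a (next6 j) ≤ᵇ suc (hexDist a j)) a j a≤5 j≤5)

hexDist-≤next : ∀ a j → a ≤ 5 → j ≤ 5 → hexDist a j ≤ suc (hexDist a (next6 j))
hexDist-≤next a j a≤5 j≤5 =
  ≤ᵇ⇒≤ _ _ (byComputation₂ (λ a j → hexDist a j ≤ᵇ suc (hexDist a (next6 j))) a j a≤5 j≤5)

towards≤5 : ∀ a j → a ≤ 5 → j ≤ 5 → towards a j ≤ 5
towards≤5 a j a≤5 j≤5 =
  ≤ᵇ⇒≤ (towards a j) 5 (byComputation₂ (λ a j → towards a j ≤ᵇ 5) a j a≤5 j≤5)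

towards-adjacent : ∀ a j → a ≤ 5 → j ≤ 5 → towards a j ≡ next6 j ⊎ next6 (towards a j) ≡ j
towards-adjacent a j a≤5 j≤5
  with Equivalence.to T-∨
         (byComputation₂ (λ a j → (towards a j ≡ᵇ next6 j) ∨ (next6 (towards a j) ≡ᵇ j)) a j a≤5 j≤5)
... | inj₁ forward  = inj₁ (≡ᵇ⇒≡ _ _ forward)
... | inj₂ backward = inj₂ (≡ᵇ⇒≡ _ _ backward)

towards-closer : ∀ a j → a ≤ 5 → j ≤ 5 → 0 < hexDist a j → suc (hexDist a (towards a j)) ≡ hexDist a j
towards-closer a j a≤5 j≤5 0<d
  with Equivalence.to T-∨
         (byComputation₂ (λ a j → (hexDist a j ≡ᵇ 0) ∨ (suc (hexDist a (towards a j)) ≡ᵇ hexDist a j))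
                         a j a≤5 j≤5)
... | inj₁ d≡0   = ⊥-elim (<-irrefl (sym (≡ᵇ⇒≡ _ 0 d≡0)) 0<d)
... | inj₂ closer = ≡ᵇ⇒≡ _ _ closer

hexDist>0 : ∀ x y → x ≤ 5 → y ≤ 5 → x ≢ y → 0 < hexDist x y
hexDist>0 x y x≤5 y≤5 x≢y = n≢0⇒n>0 (x≢y ∘ hexDist≡0⇒≡ x y x≤5 y≤5)

-- Vertex v of a chain has coordinates (k , j) when it is the vertex 5 k + j at position j
-- of hexagon H_k; positions 1 ≤ j ≤ 5 for k ≥ 1, since position 0 of H_k is the cut vertex c_k.

vertexAt : ℕ → ℕ → ℕ
vertexAt k j = 5 * k + j

coords : ℕ → ℕ × ℕ
coords 0 = 0 , 0
coords 1 = 0 , 1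
coords 2 = 0 , 2
coords 3 = 0 , 3
coords 4 = 0 , 4
coords 5 = 0 , 5
coords (suc (suc (suc (suc (suc (suc v)))))) = map₁ suc (coords (suc v))

hexOf posOf : ℕ → ℕ
hexOf v = proj₁ (coords v)
posOf v = proj₂ (coords v)

vertexAt-suc : ∀ k j → vertexAt (suc k) j ≡ 5 + vertexAt k j
vertexAt-suc k j = trans (cong (_+ j) (*-suc 5 k)) (+-assoc 5 (5 * k) j)

vertexAt-coords : ∀ v → vertexAt (hexOf v) (posOf v) ≡ v
vertexAt-coords 0 = refl
vertexAt-coords 1 = refl
vertexAt-coords 2 = refl
vertexAt-coords 3 = refl
vertexAt-coords 4 = refl
vertexAt-coords 5 = refl
vertexAt-coords (suc (suc (suc (suc (suc (suc v)))))) =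
  trans (vertexAt-suc (hexOf (suc v)) (posOf (suc v))) (cong (5 +_) (vertexAt-coords (suc v)))

posOf≤5 : ∀ v → posOf v ≤ 5
posOf≤5 0 = z≤n
posOf≤5 1 = s≤s z≤n
posOf≤5 2 = s≤s (s≤s z≤n)
posOf≤5 3 = s≤s (s≤s (s≤s z≤n))
posOf≤5 4 = s≤s (s≤s (s≤s (s≤s z≤n)))
posOf≤5 5 = ≤-refl
posOf≤5 (suc (suc (suc (suc (suc (suc v)))))) = posOf≤5 (suc v)

coords-valid : ∀ v → hexOf v ≡ 0 ⊎ 0 < posOf v
coords-valid 0 = inj₁ refl
coords-valid 1 = inj₁ refl
coords-valid 2 = inj₁ refl
coords-valid 3 = inj₁ refl
coords-valid 4 = inj₁ refl
coords-valid 5 = inj₁ refl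
coords-valid (suc (suc (suc (suc (suc (suc v)))))) = inj₂ (posOf-suc>0 v)
  where
  posOf-suc>0 : ∀ v → 0 < posOf (suc v)
  posOf-suc>0 0 = s≤s z≤n
  posOf-suc>0 1 = s≤s z≤n
  posOf-suc>0 2 = s≤s z≤n
  posOf-suc>0 3 = s≤s z≤n
  posOf-suc>0 4 = s≤s z≤n
  posOf-suc>0 (suc (suc (suc (suc (suc v))))) = posOf-suc>0 v

hexOf>0⇒posOf>0 : ∀ v → 0 < hexOf v → 0 < posOf v
hexOf>0⇒posOf>0 v 0<k with coords-valid v
... | inj₁ k≡0 = ⊥-elim (<-irrefl (sym k≡0) 0<k)
... | inj₂ 0<j = 0<j

coords-vertexAt : ∀ k j → j ≤ 5 → k ≡ 0 ⊎ 0 < j → coords (vertexAt k j) ≡ (k , j)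
coords-vertexAt zero 0 _ _ = refl
coords-vertexAt zero 1 _ _ = refl
coords-vertexAt zero 2 _ _ = refl
coords-vertexAt zero 3 _ _ = refl
coords-vertexAt zero 4 _ _ = refl
coords-vertexAt zero 5 _ _ = refl
coords-vertexAt zero (suc (suc (suc (suc (suc (suc _)))))) (s≤s (s≤s (s≤s (s≤s (s≤s ()))))) _
coords-vertexAt (suc k) j j≤5 (inj₂ 0<j) = begin
  coords (vertexAt (suc k) j)      ≡⟨ cong coords (vertexAt-suc k j) ⟩
  coords (5 + vertexAt k j)        ≡⟨ shift (vertexAt k j) (<-≤-trans 0<j (m≤n+m j (5 * k))) ⟩
  map₁ suc (coords (vertexAt k j)) ≡⟨ cong (map₁ suc) (coords-vertexAt k j j≤5 (inj₂ 0<j)) ⟩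
  (suc k , j)                      ∎
  where
  open ≡-Reasoning
  shift : ∀ y → 0 < y → coords (5 + y) ≡ map₁ suc (coords y)
  shift (suc y) _ = refl

hexOf-vertexAt : ∀ k j → j ≤ 5 → k ≡ 0 ⊎ 0 < j → hexOf (vertexAt k j) ≡ k
hexOf-vertexAt k j j≤5 valid = cong proj₁ (coords-vertexAt k j j≤5 valid)

posOf-vertexAt : ∀ k j → j ≤ 5 → k ≡ 0 ⊎ 0 < j → posOf (vertexAt k j) ≡ j
posOf-vertexAt k j j≤5 valid = cong proj₂ (coords-vertexAt k j j≤5 valid)

sumBelow-nextHexagon : ∀ k f → sumBelow (5 * suc k + 1) f
                               ≡ sumBelow (5 * k + 1) f + sumBelow 5 (λ j → f (vertexAt k (suc j)))
sumBelow-nextHexagon k f = begin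
  sumBelow (5 * suc k + 1) f
    ≡⟨ cong (λ x → sumBelow x f) (fiveMore k) ⟩
  sumBelow (5 * k + 1 + 5) f
    ≡⟨ sumBelow-split (5 * k + 1) 5 f ⟩
  sumBelow (5 * k + 1) f + sumBelow 5 (λ j → f (5 * k + 1 + j))
    ≡⟨ cong (sumBelow (5 * k + 1) f +_)
       (sumBelow-cong 5 (λ j _ → cong f (+-assoc (5 * k) 1 j))) ⟩
  sumBelow (5 * k + 1) f + sumBelow 5 (λ j → f (vertexAt k (suc j))) ∎
  where
  open ≡-Reasoning
  fiveMore : ∀ k → 5 * suc k + 1 ≡ 5 * k + 1 + 5
  fiveMore = solve-∀

hexOf< : ∀ n v → 0 < n → v ≤ 5 * n → hexOf v < n
hexOf< n v 0<n v≤5n with hexOf v in hexOf≡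
... | zero  = 0<n
... | suc h = *-cancelˡ-< 5 (suc h) n $ begin-strict
  5 * suc h                         ≡⟨ cong (5 *_) hexOf≡ ⟨
  5 * hexOf v                       ≡⟨ +-identityʳ _ ⟨
  5 * hexOf v + 0                   <⟨ +-monoʳ-< (5 * hexOf v) 0<posOf ⟩
  vertexAt (hexOf v) (posOf v)      ≡⟨ vertexAt-coords v ⟩
  v                                 ≤⟨ v≤5n ⟩
  5 * n                             ∎
  where
  open ≤-Reasoning
  0<posOf : 0 < posOf v
  0<posOf = hexOf>0⇒posOf>0 v (subst (0 <_) (sym hexOf≡) (s≤s z≤n))

-- Distances in a spiro chain

offset≤3 : ∀ t → offset t ≤ 3
offset≤3 o = s≤s z≤n
offset≤3 m = s≤s (s≤s z≤n)
offset≤3 p = ≤-refl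

offset>0 : ∀ t → 0 < offset t
offset>0 o = s≤s z≤n
offset>0 m = s≤s z≤n
offset>0 p = s≤s z≤n

Joins : ℕ → ℕ → ℕ → ℕ → Set
Joins x y w v = (x ≡ w × y ≡ v) ⊎ (x ≡ v × y ≡ w)

joins? : ℕ → ℕ → ℕ → ℕ → Bool
joins? x y w v = ((x ≡ᵇ w) ∧ (y ≡ᵇ v)) ∨ ((x ≡ᵇ v) ∧ (y ≡ᵇ w))

joins?⇒Joins : ∀ x y w v → T (joins? x y w v) → Joins x y w v
joins?⇒Joins x y w v =
  Sum.map (Product.map (≡ᵇ⇒≡ x w) (≡ᵇ⇒≡ y v) ∘ Equivalence.to T-∧)
          (Product.map (≡ᵇ⇒≡ x v) (≡ᵇ⇒≡ y w) ∘ Equivalence.to T-∧)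
  ∘ Equivalence.to T-∨

Joins⇒joins? : ∀ x y w v → Joins x y w v → T (joins? x y w v)
Joins⇒joins? x y w v =
  Equivalence.from T-∨ ∘
  Sum.map (Equivalence.from T-∧ ∘ Product.map (≡⇒≡ᵇ x w) (≡⇒≡ᵇ y v))
          (Equivalence.from T-∧ ∘ Product.map (≡⇒≡ᵇ x v) (≡⇒≡ᵇ y w))

module ChainDistance (s : List Ty) where

  -- the position in H_k of the cut vertex c_{k+1}
  exit : ℕ → ℕ
  exit zero    = 0
  exit (suc k) = offset (tyAt s k)

  exit≤3 : ∀ k → exit k ≤ 3
  exit≤3 zero    = z≤n
  exit≤3 (suc k) = offset≤3 (tyAt s k)

  exit≤5 : ∀ k → exit k ≤ 5
  exit≤5 k = ≤-trans (exit≤3 k) (m≤m+n 3 2)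

  -- between k a = d(c_{k+1}, c_a) for k < a
  between : ℕ → ℕ → ℕ
  between k zero    = 0
  between k (suc a) = if k <ᵇ a then between k a + exit a else 0

  between-step : ∀ k a → k < a → between k (suc a) ≡ between k a + exit a
  between-step k a k<a rewrite Equivalence.to T-≡ (<⇒<ᵇ k<a) = refl

  between-self : ∀ k → between k (suc k) ≡ 0
  between-self k with k <ᵇ k in k<ᵇk
  ... | false = refl
  ... | true  = ⊥-elim (<-irrefl refl (<ᵇ⇒< k k (subst T (sym k<ᵇk) _)))

  between-split : ∀ k a → suc k < a → between k a ≡ exit (suc k) + between (suc k) a
  between-split k (suc a) (s≤s 1+k≤a) with m≤n⇒m<n∨m≡n 1+k≤a
  ... | inj₁ 1+k<a = begin
    between k (suc a)                             ≡⟨ between-step k a (<-trans (n<1+n k) 1+k<a) ⟩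
    between k a + exit a                          ≡⟨ cong (_+ exit a) (between-split k a 1+k<a) ⟩
    exit (suc k) + between (suc k) a + exit a     ≡⟨ +-assoc (exit (suc k)) _ _ ⟩
    exit (suc k) + (between (suc k) a + exit a)   ≡⟨ cong (exit (suc k) +_) (between-step (suc k) a 1+k<a) ⟨
    exit (suc k) + between (suc k) (suc a)        ∎
    where open ≡-Reasoning
  ... | inj₂ refl = begin
    between k (suc (suc k))              ≡⟨ between-step k (suc k) (n<1+n k) ⟩
    between k (suc k) + exit (suc k)     ≡⟨ cong (_+ exit (suc k)) (between-self k) ⟩
    exit (suc k)                         ≡⟨ +-identityʳ _ ⟨
    exit (suc k) + 0                     ≡⟨ cong (exit (suc k) +_) (between-self (suc k)) ⟨
    exit (suc k) + between (suc k) (suc (suc k)) ∎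
    where open ≡-Reasoning

  between≤ : ∀ k a → between k a ≤ 3 * a
  between≤ k zero    = z≤n
  between≤ k (suc a) with k <ᵇ a
  ... | true  = subst (between k a + exit a ≤_) (trans (+-comm (3 * a) 3) (sym (*-suc 3 a)))
                      (+-mono-≤ (between≤ k a) (exit≤3 a))
  ... | false = z≤n

  -- For the vertex u at position q of H_a, gate a q k = (d(u, g) , position of g in H_k),
  -- where g is the vertex of H_k through which every shortest path from u enters H_k.
  gate : ℕ → ℕ → ℕ → ℕ × ℕ
  gate a q k with <-cmp k a
  ... | tri< _ _ _ = hexDist q 0 + between k a , exit k
  ... | tri≈ _ _ _ = 0 , q
  ... | tri> _ _ _ = hexDist q (exit a) + between a k , 0

  viaGate : ℕ × ℕ → ℕ → ℕ
  viaGate (d , g) j = d + hexDist g j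

  chainDist : ℕ → ℕ → ℕ
  chainDist u v = viaGate (gate (hexOf u) (posOf u) (hexOf v)) (posOf v)

  gate-< : ∀ a q k → k < a → gate a q k ≡ (hexDist q 0 + between k a , exit k)
  gate-< a q k k<a with <-cmp k a
  ... | tri< _ _ _   = refl
  ... | tri≈ k≮a _ _ = ⊥-elim (k≮a k<a)
  ... | tri> k≮a _ _ = ⊥-elim (k≮a k<a)

  gate-≡ : ∀ a q → gate a q a ≡ (0 , q)
  gate-≡ a q with <-cmp a a
  ... | tri< _ a≢a _ = ⊥-elim (a≢a refl)
  ... | tri≈ _ _ _   = refl
  ... | tri> _ a≢a _ = ⊥-elim (a≢a refl)

  gate-> : ∀ a q k → a < k → gate a q k ≡ (hexDist q (exit a) + between a k , 0)
  gate-> a q k a<k with <-cmp k a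
  ... | tri< _ _ a≮k = ⊥-elim (a≮k a<k)
  ... | tri≈ _ _ a≮k = ⊥-elim (a≮k a<k)
  ... | tri> _ _ _   = refl

  gatePos≤5 : ∀ a q k → q ≤ 5 → proj₂ (gate a q k) ≤ 5
  gatePos≤5 a q k q≤5 with <-cmp k a
  ... | tri< _ _ _ = exit≤5 k
  ... | tri≈ _ _ _ = q≤5
  ... | tri> _ _ _ = z≤n

  gateDist≤ : ∀ n a q k → a < n → k < n → proj₁ (gate a q k) ≤ 3 * n
  gateDist≤ n a q k a<n k<n with <-cmp k a
  ... | tri< _ _ _ = ≤-trans (+-mono-≤ (hexDist≤3 q 0) (between≤ k a))
                             (subst (_≤ 3 * n) (*-suc 3 a) (*-monoʳ-≤ 3 a<n))
  ... | tri≈ _ _ _ = z≤n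
  ... | tri> _ _ _ = ≤-trans (+-mono-≤ (hexDist≤3 q (exit a)) (between≤ a k))
                             (subst (_≤ 3 * n) (*-suc 3 k) (*-monoʳ-≤ 3 k<n))

  -- The cut vertex c_{k+1} is at position exit k of H_k and at position 0 of H_{k+1}.
  viaGate-cut : ∀ a q k → viaGate (gate a q k) (exit k) ≡ viaGate (gate a q (suc k)) 0
  viaGate-cut a q k with <-cmp k a
  viaGate-cut a q k | tri< k<a _ _ with m≤n⇒m<n∨m≡n k<a
  ... | inj₁ 1+k<a = begin
    hexDist q 0 + between k a + hexDist (exit k) (exit k)
      ≡⟨ cong₂ (λ x y → hexDist q 0 + x + y) (between-split k a 1+k<a) (hexDist-self (exit k)) ⟩
    hexDist q 0 + (exit (suc k) + between (suc k) a) + 0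
      ≡⟨ +-identityʳ _ ⟩
    hexDist q 0 + (exit (suc k) + between (suc k) a)
      ≡⟨ cong (hexDist q 0 +_) (+-comm (exit (suc k)) _) ⟩
    hexDist q 0 + (between (suc k) a + exit (suc k))
      ≡⟨ +-assoc (hexDist q 0) _ _ ⟨
    hexDist q 0 + between (suc k) a + exit (suc k)
      ≡⟨ cong (hexDist q 0 + between (suc k) a +_) (hexDist-0ʳ _ (exit≤3 (suc k))) ⟨
    hexDist q 0 + between (suc k) a + hexDist (exit (suc k)) 0
      ≡⟨ cong (λ g → viaGate g 0) (gate-< a q (suc k) 1+k<a) ⟨
    viaGate (gate a q (suc k)) 0 ∎
    where open ≡-Reasoning
  ... | inj₂ refl = begin
    hexDist q 0 + between k (suc k) + hexDist (exit k) (exit k)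
      ≡⟨ cong₂ (λ x y → hexDist q 0 + x + y) (between-self k) (hexDist-self (exit k)) ⟩
    hexDist q 0 + 0 + 0
      ≡⟨ trans (+-identityʳ _) (+-identityʳ _) ⟩
    hexDist q 0
      ≡⟨ cong (λ g → viaGate g 0) (gate-≡ (suc k) q) ⟨
    viaGate (gate (suc k) q (suc k)) 0 ∎
    where open ≡-Reasoning
  viaGate-cut a q .a | tri≈ _ refl _ = begin
    0 + hexDist q (exit a)
      ≡⟨ trans (cong (hexDist q (exit a) +_) (between-self a)) (+-identityʳ _) ⟨
    hexDist q (exit a) + between a (suc a)
      ≡⟨ +-identityʳ _ ⟨
    hexDist q (exit a) + between a (suc a) + 0
      ≡⟨ cong (λ g → viaGate g 0) (gate-> a q (suc a) (n<1+n a)) ⟨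
    viaGate (gate a q (suc a)) 0 ∎
    where open ≡-Reasoning
  viaGate-cut a q k | tri> _ _ a<k = begin
    hexDist q (exit a) + between a k + hexDist 0 (exit k)
      ≡⟨ cong (hexDist q (exit a) + between a k +_) (hexDist-0ˡ _ (exit≤3 k)) ⟩
    hexDist q (exit a) + between a k + exit k
      ≡⟨ +-assoc (hexDist q (exit a)) _ _ ⟩
    hexDist q (exit a) + (between a k + exit k)
      ≡⟨ cong (hexDist q (exit a) +_) (between-step a k a<k) ⟨
    hexDist q (exit a) + between a (suc k)
      ≡⟨ +-identityʳ _ ⟨
    hexDist q (exit a) + between a (suc k) + 0
      ≡⟨ cong (λ g → viaGate g 0) (gate-> a q (suc k) (m<n⇒m<1+n a<k)) ⟨
    viaGate (gate a q (suc k)) 0 ∎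
    where open ≡-Reasoning

  exit-valid : ∀ k → k ≡ 0 ⊎ 0 < exit k
  exit-valid zero    = inj₁ refl
  exit-valid (suc k) = inj₂ (offset>0 (tyAt s k))

  pos-vertexAt : ∀ k j → k ≡ 0 ⊎ 0 < j → pos s k j ≡ vertexAt k j
  pos-vertexAt zero    j       _ = refl
  pos-vertexAt (suc k) (suc j) _ = refl
  pos-vertexAt (suc k) zero (inj₁ ())
  pos-vertexAt (suc k) zero (inj₂ ())

  pos-cut : ∀ k → pos s (suc k) 0 ≡ vertexAt k (exit k)
  pos-cut zero    = refl
  pos-cut (suc k) = refl

  pos-coords : ∀ v → pos s (hexOf v) (posOf v) ≡ v
  pos-coords v = trans (pos-vertexAt (hexOf v) (posOf v) (coords-valid v)) (vertexAt-coords v)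

  vertexAt≤ : ∀ k j → j ≤ 5 → vertexAt k j ≤ 5 * suc k
  vertexAt≤ k j j≤5 =
    subst (vertexAt k j ≤_) (trans (+-comm (5 * k) 5) (sym (*-suc 5 k))) (+-monoʳ-≤ (5 * k) j≤5)

  pos≤ : ∀ k j → j ≤ 5 → pos s k j ≤ 5 * suc k
  pos≤ zero    j       j≤5 = j≤5
  pos≤ (suc k) (suc j) j≤5 = vertexAt≤ (suc k) (suc j) j≤5
  pos≤ (suc k) zero    _   = begin
    pos s (suc k) 0          ≡⟨ pos-cut k ⟩
    vertexAt k (exit k)      ≤⟨ vertexAt≤ k (exit k) (exit≤5 k) ⟩
    5 * suc k                ≤⟨ *-monoʳ-≤ 5 (n≤1+n (suc k)) ⟩
    5 * suc (suc k)          ∎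
    where open ≤-Reasoning

  pos<size : ∀ k j → k < hexCount s → j ≤ 5 → pos s k j < size (chain s)
  pos<size k j k<n j≤5 = ≤-<-trans (≤-trans (pos≤ k j j≤5) (*-monoʳ-≤ 5 k<n)) (m<m+n _ (s≤s z≤n))

  hexOf<hexCount : ∀ v → v < size (chain s) → hexOf v < hexCount s
  hexOf<hexCount v v<N =
    hexOf< (hexCount s) v (subst (0 <_) (+-comm 2 (length s)) (s≤s z≤n))
           (m<1+n⇒m≤n (subst (v <_) (+-comm (5 * hexCount s) 1) v<N))

  HexEdge : ℕ → ℕ → ℕ → ℕ → Set
  HexEdge k j w v = Joins (pos s k j) (pos s k (next6 j)) w v

  adj⇒HexEdge : ∀ w v → T (adj (chain s) w v) →
                ∃ λ k → ∃ λ j → k < hexCount s × j < 6 × HexEdge k j w v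
  adj⇒HexEdge w v w~v
    with (x , y) , e∈chain , e-joins ← find (any⁻ _ (chainEdges s) w~v)
    with _ , e∈hexagon , hexagon∈chain ← ∈-concat⁻′ (map (hexEdges s) (upTo (hexCount s))) e∈chain
    with k , k<n , refl ← ∈-map⁻ (hexEdges s) hexagon∈chain
    with j , j<6 , refl ← ∈-map⁻ (λ j → (pos s k j , pos s k (next6 j))) e∈hexagon
    = k , j , ∈-upTo⁻ k<n , ∈-upTo⁻ j<6 , joins?⇒Joins x y w v e-joins

  HexEdge⇒adj : ∀ k j w v → k < hexCount s → j < 6 → HexEdge k j w v → T (adj (chain s) w v)
  HexEdge⇒adj k j w v k<n j<6 edge = any⁺ _ (lose e∈chain (Joins⇒joins? _ _ w v edge))
    where
    e∈chain : (pos s k j , pos s k (next6 j)) ∈ chainEdges s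
    e∈chain = ∈-concat⁺′ (∈-map⁺ (λ j → (pos s k j , pos s k (next6 j))) (∈-upTo⁺ j<6))
                         (∈-map⁺ (hexEdges s) (∈-upTo⁺ k<n))

  chainDist-fromVertexAt : ∀ k j v → j ≤ 5 → 0 < j →
                           chainDist (vertexAt k j) v ≡ viaGate (gate k j (hexOf v)) (posOf v)
  chainDist-fromVertexAt k j v j≤5 0<j
    rewrite hexOf-vertexAt k j j≤5 (inj₂ 0<j) | posOf-vertexAt k j j≤5 (inj₂ 0<j) = refl

  module From (u : ℕ) (u<N : u < size (chain s)) where

    private
      a q : ℕ
      a = hexOf u
      q = posOf u

    chainDist-vertexAt : ∀ k j → j ≤ 5 → k ≡ 0 ⊎ 0 < j →
                         chainDist u (vertexAt k j) ≡ viaGate (gate a q k) j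
    chainDist-vertexAt k j j≤5 valid
      rewrite hexOf-vertexAt k j j≤5 valid | posOf-vertexAt k j j≤5 valid = refl

    chainDist-pos : ∀ k j → j ≤ 5 → chainDist u (pos s k j) ≡ viaGate (gate a q k) j
    chainDist-pos zero    j       j≤5 = chainDist-vertexAt zero j j≤5 (inj₁ refl)
    chainDist-pos (suc k) (suc j) j≤5 = chainDist-vertexAt (suc k) (suc j) j≤5 (inj₂ (s≤s z≤n))
    chainDist-pos (suc k) zero    _   = begin
      chainDist u (pos s (suc k) 0)      ≡⟨ cong (chainDist u) (pos-cut k) ⟩
      chainDist u (vertexAt k (exit k))  ≡⟨ chainDist-vertexAt k (exit k) (exit≤5 k) (exit-valid k) ⟩
      viaGate (gate a q k) (exit k)      ≡⟨ viaGate-cut a q k ⟩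
      viaGate (gate a q (suc k)) 0       ∎
      where open ≡-Reasoning

    chainDist-source : chainDist u u ≡ 0
    chainDist-source = trans (cong (λ g → viaGate g q) (gate-≡ a q)) (hexDist-self q)

    chainDist≡0⇒source : ∀ v → chainDist u v ≡ 0 → v ≡ u
    chainDist≡0⇒source v d≡0 with <-cmp (hexOf v) a
    ... | tri< k<a _ _ = ⊥-elim (<-irrefl q≡0 (hexOf>0⇒posOf>0 u (<-≤-trans (s≤s z≤n) k<a)))
      where
      q≡0 : 0 ≡ q
      q≡0 = sym (hexDist≡0⇒≡ q 0 (posOf≤5 u) z≤n (m+n≡0⇒m≡0 _ (m+n≡0⇒m≡0 _ d≡0)))
    ... | tri≈ _ k≡a _ = begin
      v
        ≡⟨ vertexAt-coords v ⟨
      vertexAt (hexOf v) (posOf v)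
        ≡⟨ cong₂ vertexAt k≡a (sym (hexDist≡0⇒≡ q (posOf v) (posOf≤5 u) (posOf≤5 v) d≡0)) ⟩
      vertexAt a q
        ≡⟨ vertexAt-coords u ⟩
      u ∎
      where open ≡-Reasoning
    ... | tri> _ _ a<k = ⊥-elim (<-irrefl 0≡j (hexOf>0⇒posOf>0 v (<-≤-trans (s≤s z≤n) a<k)))
      where
      0≡j : 0 ≡ posOf v
      0≡j = hexDist≡0⇒≡ 0 (posOf v) z≤n (posOf≤5 v) (m+n≡0⇒n≡0 _ d≡0)

    private
      gatePos : ℕ → ℕ
      gatePos k = proj₂ (gate a q k)

      gatePos≤ : ∀ k → gatePos k ≤ 5
      gatePos≤ k = gatePos≤5 a q k (posOf≤5 u)

    chainDist-adj : ∀ w v → T (adj (chain s) w v) → chainDist u v ≤ suc (chainDist u w)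
    chainDist-adj w v w~v with adj⇒HexEdge w v w~v
    ... | k , j , _ , s≤s j≤5 , inj₁ (refl , refl) = begin
      chainDist u (pos s k (next6 j))
        ≡⟨ chainDist-pos k (next6 j) (next6≤5 j j≤5) ⟩
      viaGate (gate a q k) (next6 j)
        ≤⟨ +-monoʳ-≤ (proj₁ (gate a q k)) (hexDist-next≤ (gatePos k) j (gatePos≤ k) j≤5) ⟩
      proj₁ (gate a q k) + suc (hexDist (gatePos k) j)
        ≡⟨ +-suc _ _ ⟩
      suc (viaGate (gate a q k) j)
        ≡⟨ cong suc (chainDist-pos k j j≤5) ⟨
      suc (chainDist u (pos s k j)) ∎
      where open ≤-Reasoning
    ... | k , j , _ , s≤s j≤5 , inj₂ (refl , refl) = begin
      chainDist u (pos s k j)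
        ≡⟨ chainDist-pos k j j≤5 ⟩
      viaGate (gate a q k) j
        ≤⟨ +-monoʳ-≤ (proj₁ (gate a q k)) (hexDist-≤next (gatePos k) j (gatePos≤ k) j≤5) ⟩
      proj₁ (gate a q k) + suc (hexDist (gatePos k) (next6 j))
        ≡⟨ +-suc _ _ ⟩
      suc (viaGate (gate a q k) (next6 j))
        ≡⟨ cong suc (chainDist-pos k (next6 j) (next6≤5 j j≤5)) ⟨
      suc (chainDist u (pos s k (next6 j))) ∎
      where open ≤-Reasoning

    HasCloserNeighbour : ℕ → Set
    HasCloserNeighbour v =
      ∃ λ w → w < size (chain s) × T (adj (chain s) w v) × suc (chainDist u w) ≡ chainDist u v

    closerInHexagon : ∀ k j → k < hexCount s → j ≤ 5 → 0 < hexDist (gatePos k) j →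
                      HasCloserNeighbour (pos s k j)
    closerInHexagon k j k<n j≤5 0<d = pos s k j′ , pos<size k j′ k<n j′≤5 , adjacent , closer
      where
      j′ : ℕ
      j′ = towards (gatePos k) j
      j′≤5 : j′ ≤ 5
      j′≤5 = towards≤5 (gatePos k) j (gatePos≤ k) j≤5
      adjacent : T (adj (chain s) (pos s k j′) (pos s k j))
      adjacent with towards-adjacent (gatePos k) j (gatePos≤ k) j≤5
      ... | inj₁ j′≡next = HexEdge⇒adj k j _ _ k<n (s≤s j≤5) (inj₂ (refl , cong (pos s k) (sym j′≡next)))
      ... | inj₂ next≡j  = HexEdge⇒adj k j′ _ _ k<n (s≤s j′≤5) (inj₁ (refl , cong (pos s k) next≡j))
      closer : suc (chainDist u (pos s k j′)) ≡ chainDist u (pos s k j)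
      closer = begin
        suc (chainDist u (pos s k j′))
          ≡⟨ cong suc (chainDist-pos k j′ j′≤5) ⟩
        suc (viaGate (gate a q k) j′)
          ≡⟨ +-suc _ _ ⟨
        proj₁ (gate a q k) + suc (hexDist (gatePos k) j′)
          ≡⟨ cong (proj₁ (gate a q k) +_)
             (towards-closer (gatePos k) j (gatePos≤ k) j≤5 0<d) ⟩
        viaGate (gate a q k) j
          ≡⟨ chainDist-pos k j j≤5 ⟨
        chainDist u (pos s k j) ∎
        where open ≡-Reasoning

    cutAwayFromGate : ∀ k → suc k ≤ a → 0 < hexDist (gatePos (suc k)) 0
    cutAwayFromGate k 1+k≤a with m≤n⇒m<n∨m≡n 1+k≤a
    ... | inj₁ 1+k<a = subst (λ g → 0 < hexDist (proj₂ g) 0) (sym (gate-< a q (suc k) 1+k<a))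
                             (subst (0 <_) (sym (hexDist-0ʳ _ (exit≤3 (suc k)))) (offset>0 (tyAt s k)))
    ... | inj₂ 1+k≡a = subst (λ k′ → 0 < hexDist (gatePos k′) 0) (sym 1+k≡a)
                         (subst (λ g → 0 < hexDist (proj₂ g) 0) (sym (gate-≡ a q)) 0<q,0)
      where
      0<q,0 : 0 < hexDist q 0
      0<q,0 = hexDist>0 q 0 (posOf≤5 u) z≤n
                (>⇒≢ (hexOf>0⇒posOf>0 u (subst (0 <_) 1+k≡a (s≤s z≤n))))

    AwayFromGate : ℕ → Set
    AwayFromGate v = ∃ λ k → ∃ λ j → k < hexCount s × j ≤ 5 × pos s k j ≡ v × 0 < hexDist (gatePos k) j

    ownHexagon : ∀ v → v < size (chain s) → 0 < hexDist (gatePos (hexOf v)) (posOf v) → AwayFromGate v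
    ownHexagon v v<N 0<d = hexOf v , posOf v , hexOf<hexCount v v<N , posOf≤5 v , pos-coords v , 0<d

    -- A vertex other than u either is not the gate of its own hexagon, or it is the cut
    -- vertex c_{k+1} on the way from H_k to u, and then it is not the gate of H_{k+1}.
    awayFromGate : ∀ v → v < size (chain s) → 0 < chainDist u v → AwayFromGate v
    awayFromGate v v<N 0<D = byPosition (<-cmp (hexOf v) a)
      where
      k j : ℕ
      k = hexOf v
      j = posOf v

      gateAt : ∀ {g} → gate a q k ≡ g → 0 < hexDist (proj₂ g) j → 0 < hexDist (gatePos k) j
      gateAt gate≡ = subst (λ g → 0 < hexDist (proj₂ g) j) (sym gate≡)

      byPosition : Tri (k < a) (k ≡ a) (a < k) → AwayFromGate v
      byPosition (tri≈ _ k≡a _) = ownHexagon v v<N (gateAt aligned (subst (λ g → 0 < viaGate g j) aligned 0<D))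
        where
        aligned : gate a q k ≡ (0 , q)
        aligned = trans (cong (gate a q) k≡a) (gate-≡ a q)
      byPosition (tri> _ _ a<k) = ownHexagon v v<N (gateAt (gate-> a q k a<k)
        (hexDist>0 0 j z≤n (posOf≤5 v) (<⇒≢ (hexOf>0⇒posOf>0 v (<-≤-trans (s≤s z≤n) a<k)))))
      byPosition (tri< k<a _ _) with hexDist (exit k) j ≟ 0
      ... | no d≢0  = ownHexagon v v<N (gateAt (gate-< a q k k<a) (n≢0⇒n>0 d≢0))
      ... | yes d≡0 = suc k , 0 , ≤-<-trans k<a (hexOf<hexCount u u<N) , z≤n , v≡cut , cutAwayFromGate k k<a
        where
        v≡cut : pos s (suc k) 0 ≡ v
        v≡cut = begin
          pos s (suc k) 0       ≡⟨ pos-cut k ⟩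
          vertexAt k (exit k)   ≡⟨ cong (vertexAt k) (hexDist≡0⇒≡ (exit k) j (exit≤5 k) (posOf≤5 v) d≡0) ⟩
          vertexAt k j          ≡⟨ vertexAt-coords v ⟩
          v                     ∎
          where open ≡-Reasoning

    chainDist-pred : ∀ v → v < size (chain s) → ∀ d → chainDist u v ≡ suc d →
                     ∃ λ w → w < size (chain s) × T (adj (chain s) w v) × chainDist u w ≡ d
    chainDist-pred v v<N d D≡1+d
      with k , j , k<n , j≤5 , refl , 0<hd ← awayFromGate v v<N (subst (0 <_) (sym D≡1+d) (s≤s z≤n))
      with w , w<N , w~v , closer ← closerInHexagon k j k<n j≤5 0<hd
      = w , w<N , w~v , suc-injective (trans closer D≡1+d)

    chainDist≤size : ∀ v → v < size (chain s) → chainDist u v ≤ size (chain s)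
    chainDist≤size v v<N = begin
      chainDist u v
        ≤⟨ +-mono-≤ (gateDist≤ n a q (hexOf v) (hexOf<hexCount u u<N) (hexOf<hexCount v v<N))
                    (hexDist≤3 (gatePos (hexOf v)) (posOf v)) ⟩
      3 * n + 3
        ≤⟨ m≤m+n (3 * n + 3) (2 * length s + 2) ⟩
      3 * n + 3 + (2 * length s + 2)
        ≡⟨ spare (length s) ⟩
      5 * n + 1 ∎
      where
      open ≤-Reasoning
      n : ℕ
      n = hexCount s
      spare : ∀ L → 3 * (L + 2) + 3 + (2 * L + 2) ≡ 5 * (L + 2) + 1
      spare = solve-∀

    dist≡chainDist : ∀ v → v < size (chain s) → dist (chain s) u v ≡ chainDist u v
    dist≡chainDist v v<N =
      BFSLabelling.dist≡ (chain s) u (chainDist u) u<N chainDist-source chainDist≡0⇒source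
                         chainDist-adj chainDist-pred v v<N (chainDist≤size v v<N)

-- The Wiener index

hexagonRows : ∀ X S → sumBelow 5 (λ j → X * hexDist (suc j) 0 + S + sumBelow j (λ i → hexDist (suc j) (suc i)))
                      ≡ 9 * X + 5 * S + 18
hexagonRows = unrolled
  where
  unrolled : ∀ X S → (X * 1 + S + 0) + (X * 2 + S + 1) + (X * 3 + S + 3) + (X * 2 + S + 6) + (X * 1 + S + 8)
                     ≡ 9 * X + 5 * S + 18
  unrolled = solve-∀

hexagonTransmission : ∀ t → sumBelow 5 (λ j → hexDist (offset t) (suc j)) + offset t ≡ 9
hexagonTransmission o = refl
hexagonTransmission m = refl
hexagonTransmission p = refl

wienerConstant : ℕ → ℕ
wienerConstant k = sumBelow k (λ i → 90 * i + 27)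

module ChainWiener (s : List Ty) where
  open ChainDistance s

  -- d(c_k, v) for v in H_0 ∪ ⋯ ∪ H_{k-1}
  distFromCut : ℕ → ℕ → ℕ
  distFromCut k v = between (hexOf v) k + hexDist (exit (hexOf v)) (posOf v)

  cutTransmission : ℕ → ℕ
  cutTransmission k = sumBelow (5 * k + 1) (distFromCut k)

  wienerBelow : ℕ → ℕ
  wienerBelow k = sumBelow (5 * k + 1) (λ u → sumBelow u (chainDist u))

  wiener≡wienerBelow : wiener (chain s) ≡ wienerBelow (hexCount s)
  wiener≡wienerBelow =
    trans (sum-map-upTo N _) (sumBelow-cong N (λ u u<N →
      trans (sum-map-upTo u _) (sumBelow-cong u (λ v v<u →
        From.dist≡chainDist u u<N v (<-trans v<u u<N)))))
    where
    N : ℕ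
    N = size (chain s)

  private
    oldVertex : ∀ k v → v < 5 * suc k + 1 → hexOf v < suc k
    oldVertex k v v<X = hexOf< (suc k) v (s≤s z≤n) (m<1+n⇒m≤n (subst (v <_) (+-comm (5 * suc k) 1) v<X))

  newVertex-old : ∀ k j v → j < 5 → hexOf v < suc k →
                  chainDist (vertexAt (suc k) (suc j)) v ≡ hexDist (suc j) 0 + distFromCut (suc k) v
  newVertex-old k j v j<5 v∈old = begin
    chainDist (vertexAt (suc k) (suc j)) v
      ≡⟨ chainDist-fromVertexAt (suc k) (suc j) v j<5 (s≤s z≤n) ⟩
    viaGate (gate (suc k) (suc j) (hexOf v)) (posOf v)
      ≡⟨ cong (λ g → viaGate g (posOf v)) (gate-< (suc k) (suc j) (hexOf v) v∈old) ⟩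
    hexDist (suc j) 0 + between (hexOf v) (suc k) + hexDist (exit (hexOf v)) (posOf v)
      ≡⟨ +-assoc (hexDist (suc j) 0) _ _ ⟩
    hexDist (suc j) 0 + distFromCut (suc k) v ∎
    where open ≡-Reasoning

  newVertex-new : ∀ k j i → j < 5 → i < 5 →
                  chainDist (vertexAt (suc k) (suc j)) (vertexAt (suc k) (suc i)) ≡ hexDist (suc j) (suc i)
  newVertex-new k j i j<5 i<5
    rewrite chainDist-fromVertexAt (suc k) (suc j) (vertexAt (suc k) (suc i)) j<5 (s≤s z≤n)
          | hexOf-vertexAt (suc k) (suc i) i<5 (inj₂ (s≤s z≤n))
          | posOf-vertexAt (suc k) (suc i) i<5 (inj₂ (s≤s z≤n))
          | gate-≡ (suc k) (suc j) = refl

  transmission-newVertex : ∀ k j → j < 5 →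
    sumBelow (vertexAt (suc k) (suc j)) (chainDist (vertexAt (suc k) (suc j)))
      ≡ (5 * suc k + 1) * hexDist (suc j) 0 + cutTransmission (suc k) + sumBelow j (λ i → hexDist (suc j) (suc i))
  transmission-newVertex k j j<5 = begin
    sumBelow (vertexAt (suc k) (suc j)) (chainDist u)
      ≡⟨ cong (λ x → sumBelow x (chainDist u)) (+-assoc (5 * suc k) 1 j) ⟨
    sumBelow (X + j) (chainDist u)
      ≡⟨ sumBelow-split X j (chainDist u) ⟩
    sumBelow X (chainDist u) + sumBelow j (λ i → chainDist u (X + i))
      ≡⟨ cong₂ _+_ old new ⟩
    X * hexDist (suc j) 0 + cutTransmission (suc k) + sumBelow j (λ i → hexDist (suc j) (suc i)) ∎
    where
    open ≡-Reasoning
    X u : ℕ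
    X = 5 * suc k + 1
    u = vertexAt (suc k) (suc j)
    old : sumBelow X (chainDist u) ≡ X * hexDist (suc j) 0 + cutTransmission (suc k)
    old = begin
      sumBelow X (chainDist u)
        ≡⟨ sumBelow-cong X (λ v v<X → newVertex-old k j v j<5 (oldVertex k v v<X)) ⟩
      sumBelow X (λ v → hexDist (suc j) 0 + distFromCut (suc k) v)
        ≡⟨ sumBelow-+ X (λ _ → hexDist (suc j) 0) (distFromCut (suc k)) ⟩
      sumBelow X (λ _ → hexDist (suc j) 0) + cutTransmission (suc k)
        ≡⟨ cong (_+ cutTransmission (suc k)) (sumBelow-const X (hexDist (suc j) 0)) ⟩
      X * hexDist (suc j) 0 + cutTransmission (suc k) ∎
    new : sumBelow j (λ i → chainDist u (X + i)) ≡ sumBelow j (λ i → hexDist (suc j) (suc i))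
    new = sumBelow-cong j (λ i i<j → trans (cong (chainDist u) (+-assoc (5 * suc k) 1 i))
                                           (newVertex-new k j i j<5 (<-trans i<j j<5)))

  wienerBelow-step : ∀ k → wienerBelow (suc (suc k))
                           ≡ wienerBelow (suc k) + (9 * (5 * suc k + 1) + 5 * cutTransmission (suc k) + 18)
  wienerBelow-step k = begin
    wienerBelow (suc (suc k))
      ≡⟨ sumBelow-nextHexagon (suc k) (λ u → sumBelow u (chainDist u)) ⟩
    wienerBelow (suc k) + sumBelow 5 (λ j → sumBelow (vertexAt (suc k) (suc j)) (chainDist (vertexAt (suc k) (suc j))))
      ≡⟨ cong (wienerBelow (suc k) +_) (sumBelow-cong 5 (λ j j<5 → transmission-newVertex k j j<5)) ⟩
    wienerBelow (suc k) + sumBelow 5 (λ j → (5 * suc k + 1) * hexDist (suc j) 0 + cutTransmission (suc k)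
                                            + sumBelow j (λ i → hexDist (suc j) (suc i)))
      ≡⟨ cong (wienerBelow (suc k) +_) (hexagonRows (5 * suc k + 1) (cutTransmission (suc k))) ⟩
    wienerBelow (suc k) + (9 * (5 * suc k + 1) + 5 * cutTransmission (suc k) + 18) ∎
    where open ≡-Reasoning

  distFromCut-old : ∀ k v → hexOf v < suc k → distFromCut (suc (suc k)) v ≡ distFromCut (suc k) v + exit (suc k)
  distFromCut-old k v v∈old =
    trans (cong (_+ hexDist (exit (hexOf v)) (posOf v)) (between-step (hexOf v) (suc k) v∈old))
          (xy∙z≈xz∙y (between (hexOf v) (suc k)) (exit (suc k)) _)

  distFromCut-new : ∀ k j → j < 5 →
                    distFromCut (suc (suc k)) (vertexAt (suc k) (suc j)) ≡ hexDist (exit (suc k)) (suc j)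
  distFromCut-new k j j<5 = begin
    distFromCut (suc (suc k)) (vertexAt (suc k) (suc j))
      ≡⟨ cong₂ (λ h i → between h (suc (suc k)) + hexDist (exit h) i)
               (hexOf-vertexAt (suc k) (suc j) j<5 (inj₂ (s≤s z≤n)))
               (posOf-vertexAt (suc k) (suc j) j<5 (inj₂ (s≤s z≤n))) ⟩
    between (suc k) (suc (suc k)) + hexDist (exit (suc k)) (suc j)
      ≡⟨ cong (_+ hexDist (exit (suc k)) (suc j)) (between-self (suc k)) ⟩
    hexDist (exit (suc k)) (suc j) ∎
    where open ≡-Reasoning

  cutTransmission-step : ∀ k → cutTransmission (suc (suc k)) + exit (suc k)
                               ≡ cutTransmission (suc k) + (5 * suc k + 1) * exit (suc k) + 9
  cutTransmission-step k = begin
    cutTransmission (suc (suc k)) + f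
      ≡⟨ cong (_+ f) (sumBelow-nextHexagon (suc k) (distFromCut (suc (suc k)))) ⟩
    sumBelow X (distFromCut (suc (suc k))) + sumBelow 5 (λ j → distFromCut (suc (suc k)) (vertexAt (suc k) (suc j))) + f
      ≡⟨ cong₂ (λ x y → x + y + f) (sumBelow-cong X (λ v v<X → distFromCut-old k v (oldVertex k v v<X)))
                                   (sumBelow-cong 5 (distFromCut-new k)) ⟩
    sumBelow X (λ v → distFromCut (suc k) v + f) + sumBelow 5 (λ j → hexDist f (suc j)) + f
      ≡⟨ cong (λ x → x + sumBelow 5 (λ j → hexDist f (suc j)) + f) (sumBelow-+ X (distFromCut (suc k)) (λ _ → f)) ⟩
    cutTransmission (suc k) + sumBelow X (λ _ → f) + sumBelow 5 (λ j → hexDist f (suc j)) + f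
      ≡⟨ cong (λ x → cutTransmission (suc k) + x + sumBelow 5 (λ j → hexDist f (suc j)) + f) (sumBelow-const X f) ⟩
    cutTransmission (suc k) + X * f + sumBelow 5 (λ j → hexDist f (suc j)) + f
      ≡⟨ +-assoc (cutTransmission (suc k) + X * f) _ _ ⟩
    cutTransmission (suc k) + X * f + (sumBelow 5 (λ j → hexDist f (suc j)) + f)
      ≡⟨ cong (cutTransmission (suc k) + X * f +_) (hexagonTransmission (tyAt s k)) ⟩
    cutTransmission (suc k) + X * f + 9 ∎
    where
    open ≡-Reasoning
    X f : ℕ
    X = 5 * suc k + 1
    f = exit (suc k)

  cutTransmission≡ : ∀ k → cutTransmission (suc k) ≡ 9 * suc k + 5 * moment exit (suc k)
  cutTransmission≡ zero    = refl
  cutTransmission≡ (suc k) = +-cancelʳ-≡ f _ _ $ begin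
    cutTransmission (suc (suc k)) + f
      ≡⟨ cutTransmission-step k ⟩
    cutTransmission (suc k) + (5 * suc k + 1) * f + 9
      ≡⟨ cong (λ x → x + (5 * suc k + 1) * f + 9) (cutTransmission≡ k) ⟩
    9 * suc k + 5 * moment exit (suc k) + (5 * suc k + 1) * f + 9
      ≡⟨ regroup k (moment exit (suc k)) f ⟩
    9 * suc (suc k) + 5 * (moment exit (suc k) + suc k * f) + f ∎
    where
    open ≡-Reasoning
    f : ℕ
    f = exit (suc k)
    regroup : ∀ k M f → 9 * suc k + 5 * M + (5 * suc k + 1) * f + 9 ≡ 9 * suc (suc k) + 5 * (M + suc k * f) + f
    regroup = solve-∀

  wienerBelow≡ : ∀ k → wienerBelow (suc k) ≡ wienerConstant (suc k) + 25 * moment₂ exit (suc k)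
  wienerBelow≡ zero    = refl
  wienerBelow≡ (suc k) = begin
    wienerBelow (suc (suc k))
      ≡⟨ wienerBelow-step k ⟩
    wienerBelow (suc k) + (9 * (5 * suc k + 1) + 5 * cutTransmission (suc k) + 18)
      ≡⟨ cong₂ (λ x y → x + (9 * (5 * suc k + 1) + 5 * y + 18)) (wienerBelow≡ k) (cutTransmission≡ k) ⟩
    C + 25 * M₂ + (9 * (5 * suc k + 1) + 5 * (9 * suc k + 5 * M) + 18)
      ≡⟨ regroup k C M₂ M ⟩
    C + (90 * suc k + 27) + 25 * (M₂ + M) ∎
    where
    open ≡-Reasoning
    C M M₂ : ℕ
    C  = wienerConstant (suc k)
    M  = moment exit (suc k)
    M₂ = moment₂ exit (suc k)
    regroup : ∀ k C M₂ M → C + 25 * M₂ + (9 * (5 * suc k + 1) + 5 * (9 * suc k + 5 * M) + 18)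
                           ≡ C + (90 * suc k + 27) + 25 * (M₂ + M)
    regroup = solve-∀

  wiener≡moment₂ : wiener (chain s) ≡ wienerConstant (hexCount s) + 25 * moment₂ exit (hexCount s)
  wiener≡moment₂ = begin
    wiener (chain s)
      ≡⟨ wiener≡wienerBelow ⟩
    wienerBelow (hexCount s)
      ≡⟨ cong wienerBelow n≡ ⟩
    wienerBelow (suc (length s + 1))
      ≡⟨ wienerBelow≡ (length s + 1) ⟩
    wienerConstant (suc (length s + 1)) + 25 * moment₂ exit (suc (length s + 1))
      ≡⟨ cong (λ n → wienerConstant n + 25 * moment₂ exit n) n≡ ⟨
    wienerConstant (hexCount s) + 25 * moment₂ exit (hexCount s) ∎
    where
    open ≡-Reasoning
    n≡ : hexCount s ≡ suc (length s + 1)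
    n≡ = +-suc (length s) 1

-- Excess and the extremal chains

excessOf : Ty → ℕ
excessOf o = 0
excessOf m = 1
excessOf p = 2

excessAt : List Ty → ℕ → ℕ
excessAt s zero    = 0
excessAt s (suc j) = excessOf (tyAt s j)

orthoExit : ℕ → ℕ
orthoExit zero    = 0
orthoExit (suc _) = 1

exit≡ : ∀ s k → ChainDistance.exit s k ≡ orthoExit k + excessAt s k
exit≡ s zero    = refl
exit≡ s (suc k) with tyAt s k
... | o = refl
... | m = refl
... | p = refl

excess : List Ty → ℕ
excess s = moment₂ (excessAt s) (hexCount s)

orthoWiener : ℕ → ℕ
orthoWiener L = wienerConstant (L + 2) + 25 * moment₂ orthoExit (L + 2)

wiener≡excess : ∀ s → wiener (chain s) ≡ orthoWiener (length s) + 25 * excess s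
wiener≡excess s = begin
  wiener (chain s)
    ≡⟨ ChainWiener.wiener≡moment₂ s ⟩
  wienerConstant n + 25 * moment₂ (ChainDistance.exit s) n
    ≡⟨ cong (λ x → wienerConstant n + 25 * x) split ⟩
  wienerConstant n + 25 * (moment₂ orthoExit n + excess s)
    ≡⟨ cong (wienerConstant n +_) (*-distribˡ-+ 25 (moment₂ orthoExit n) (excess s)) ⟩
  wienerConstant n + (25 * moment₂ orthoExit n + 25 * excess s)
    ≡⟨ +-assoc (wienerConstant n) _ _ ⟨
  orthoWiener (length s) + 25 * excess s ∎
  where
  open ≡-Reasoning
  n : ℕ
  n = hexCount s
  split : moment₂ (ChainDistance.exit s) n ≡ moment₂ orthoExit n + excess s
  split = trans (moment₂-cong (exit≡ s) n) (moment₂-+ orthoExit (excessAt s) n)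

wiener-< : ∀ s t → length s ≡ length t → excess s < excess t → wiener (chain s) < wiener (chain t)
wiener-< s t |s|≡|t| excess< = begin-strict
  wiener (chain s)                             ≡⟨ wiener≡excess s ⟩
  orthoWiener (length s) + 25 * excess s       <⟨ +-monoʳ-< (orthoWiener (length s)) (*-monoʳ-< 25 excess<) ⟩
  orthoWiener (length s) + 25 * excess t       ≡⟨ cong (λ L → orthoWiener L + 25 * excess t) |s|≡|t| ⟩
  orthoWiener (length t) + 25 * excess t       ≡⟨ wiener≡excess t ⟨
  wiener (chain t)                             ∎
  where open ≤-Reasoning

oneMeta : ℕ → ℕ → List Ty
oneMeta j r = replicate j o ++ m ∷ replicate r o

length-oneMeta : ∀ j r → length (oneMeta j r) ≡ j + suc r
length-oneMeta j r =
  trans (length-++ (replicate j o)) (cong₂ _+_ (length-replicate j) (cong suc (length-replicate r)))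

reverse-replicate : ∀ {A : Set} k (x : A) → reverse (replicate k x) ≡ replicate k x
reverse-replicate zero    x = refl
reverse-replicate (suc k) x = begin
  reverse (replicate (suc k) x)    ≡⟨ unfold-reverse x (replicate k x) ⟩
  reverse (replicate k x) ∷ʳ x     ≡⟨ cong (_∷ʳ x) (reverse-replicate k x) ⟩
  replicate k x ∷ʳ x               ≡⟨ replicate-∷ʳ k ⟩
  replicate (suc k) x              ∎
  where
  open ≡-Reasoning
  replicate-∷ʳ : ∀ k → replicate k x ∷ʳ x ≡ x ∷ replicate k x
  replicate-∷ʳ zero    = refl
  replicate-∷ʳ (suc k) = cong (x ∷_) (replicate-∷ʳ k)

reverse-oneMeta : ∀ j r → reverse (oneMeta j r) ≡ oneMeta r j
reverse-oneMeta j r = begin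
  reverse (replicate j o ++ m ∷ replicate r o)
    ≡⟨ reverse-++ (replicate j o) (m ∷ replicate r o) ⟩
  reverse (m ∷ replicate r o) ++ reverse (replicate j o)
    ≡⟨ cong₂ _++_ (unfold-reverse m (replicate r o))
                  (reverse-replicate j o) ⟩
  (reverse (replicate r o) ∷ʳ m) ++ replicate j o
    ≡⟨ cong (λ xs → (xs ∷ʳ m) ++ replicate j o) (reverse-replicate r o) ⟩
  (replicate r o ∷ʳ m) ++ replicate j o
    ≡⟨ ++-assoc (replicate r o) (m ∷ []) (replicate j o) ⟩
  oneMeta r j ∎
  where open ≡-Reasoning

tyAt-replicate : ∀ k x → tyAt (replicate k o) x ≡ o
tyAt-replicate zero    x       = refl
tyAt-replicate (suc k) zero    = refl
tyAt-replicate (suc k) (suc x) = tyAt-replicate k x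

excessAt-replicate : ∀ k x → excessAt (replicate k o) x ≡ 0
excessAt-replicate k zero    = refl
excessAt-replicate k (suc x) = cong excessOf (tyAt-replicate k x)

excess-replicate : ∀ k → excess (replicate k o) ≡ 0
excess-replicate k =
  trans (moment₂-cong (excessAt-replicate k) (hexCount (replicate k o))) (moment₂-zero (hexCount (replicate k o)))

excessAt-oneMeta : ∀ j r x → excessAt (oneMeta j r) x ≡ indicator (suc j) x
excessAt-oneMeta zero    r zero          = refl
excessAt-oneMeta zero    r (suc zero)    = refl
excessAt-oneMeta zero    r (suc (suc x)) = cong excessOf (tyAt-replicate r x)
excessAt-oneMeta (suc j) r zero          = refl
excessAt-oneMeta (suc j) r (suc zero)    = refl
excessAt-oneMeta (suc j) r (suc (suc x)) = excessAt-oneMeta j r (suc x)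

excess-oneMeta : ∀ j r → excess (oneMeta j r) ≡ suc j * suc r
excess-oneMeta j r = begin
  moment₂ (excessAt (oneMeta j r)) (length (oneMeta j r) + 2)
    ≡⟨ moment₂-cong (excessAt-oneMeta j r) (length (oneMeta j r) + 2) ⟩
  moment₂ (indicator (suc j)) (length (oneMeta j r) + 2)
    ≡⟨ cong (λ L → moment₂ (indicator (suc j)) (L + 2)) (length-oneMeta j r) ⟩
  moment₂ (indicator (suc j)) (j + suc r + 2)
    ≡⟨ cong (moment₂ (indicator (suc j))) (shape j r) ⟩
  moment₂ (indicator (suc j)) (suc (suc j) + suc r)
    ≡⟨ moment₂-indicator (suc j) (suc r) ⟩
  suc j * suc r ∎
  where
  open ≡-Reasoning
  shape : ∀ j r → j + suc r + 2 ≡ suc (suc j) + suc r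
  shape = solve-∀

excessOf≥1 : ∀ t → t ≢ o → 1 ≤ excessOf t
excessOf≥1 o t≢o = ⊥-elim (t≢o refl)
excessOf≥1 m _   = s≤s z≤n
excessOf≥1 p _   = s≤s z≤n

-- moment₂ (indicator (suc j)) (L + 2) = (j + 1) (L - j) is the weight of position j in excess
weight≥ : ∀ L j → j < L → L ≤ moment₂ (indicator (suc j)) (L + 2)
weight≥ L j j<L = begin
  L                                                   ≡⟨ L≡ ⟨
  suc j + r                                           ≤⟨ m≤m+n (suc j + r) (j * r) ⟩
  suc j + r + j * r                                   ≡⟨ product j r ⟩
  suc j * suc r                                       ≡⟨ moment₂-indicator (suc j) (suc r) ⟨
  moment₂ (indicator (suc j)) (suc (suc j) + suc r)   ≡⟨ cong (moment₂ (indicator (suc j))) (shape j r) ⟩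
  moment₂ (indicator (suc j)) (suc j + r + 2)         ≡⟨ cong (λ n → moment₂ (indicator (suc j)) (n + 2)) L≡ ⟩
  moment₂ (indicator (suc j)) (L + 2)                 ∎
  where
  open ≤-Reasoning
  r : ℕ
  r = L ∸ suc j
  L≡ : suc j + r ≡ L
  L≡ = m+[n∸m]≡n j<L
  product : ∀ j r → suc j + r + j * r ≡ suc j * suc r
  product = solve-∀
  shape : ∀ j r → suc (suc j) + suc r ≡ suc j + r + 2
  shape = solve-∀

pair≤excess : ∀ s i j → i < length s → j < length s →
              (∀ x → indicator (suc i) x + indicator (suc j) x ≤ excessAt s x) → 2 * length s ≤ excess s
pair≤excess s i j i<L j<L pointwise = begin
  2 * L
    ≡⟨ cong (L +_) (+-identityʳ L) ⟩
  L + L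
    ≤⟨ +-mono-≤ (weight≥ L i i<L) (weight≥ L j j<L) ⟩
  moment₂ (indicator (suc i)) n + moment₂ (indicator (suc j)) n
    ≡⟨ moment₂-+ (indicator (suc i)) (indicator (suc j)) n ⟨
  moment₂ (λ x → indicator (suc i) x + indicator (suc j) x) n
    ≤⟨ moment₂-mono pointwise n ⟩
  excess s ∎
  where
  open ≤-Reasoning
  L n : ℕ
  L = length s
  n = hexCount s

data Heavy (s : List Ty) : Set where
  para        : ∀ j → j < length s → tyAt s j ≡ p → Heavy s
  twoNonOrtho : ∀ i j → i < j → j < length s → tyAt s i ≢ o → tyAt s j ≢ o → Heavy s

Heavy-∷ : ∀ t {s} → Heavy s → Heavy (t ∷ s)
Heavy-∷ t (para j j<L tj≡p)                = para (suc j) (s≤s j<L) tj≡p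
Heavy-∷ t (twoNonOrtho i j i<j j<L ti≢o tj≢o) = twoNonOrtho (suc i) (suc j) (s≤s i<j) (s≤s j<L) ti≢o tj≢o

Heavy⇒2L≤excess : ∀ {s} → Heavy s → 2 * length s ≤ excess s
Heavy⇒2L≤excess {s} (para j j<L tj≡p) = pair≤excess s j j j<L j<L pointwise
  where
  pointwise : ∀ x → indicator (suc j) x + indicator (suc j) x ≤ excessAt s x
  pointwise x with x ≟ suc j
  ... | yes refl rewrite indicator-≡ (suc j) | tj≡p = ≤-refl
  ... | no x≢j   rewrite indicator-≢ (suc j) x x≢j  = z≤n
Heavy⇒2L≤excess {s} (twoNonOrtho i j i<j j<L ti≢o tj≢o) = pair≤excess s i j (<-trans i<j j<L) j<L pointwise
  where
  pointwise : ∀ x → indicator (suc i) x + indicator (suc j) x ≤ excessAt s x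
  pointwise x with x ≟ suc i | x ≟ suc j
  ... | yes refl | _ rewrite indicator-≡ (suc i) | indicator-≢ (suc j) (suc i) (<⇒≢ (s≤s i<j)) =
    excessOf≥1 (tyAt s i) ti≢o
  ... | no x≢i | yes refl rewrite indicator-≢ (suc i) (suc j) x≢i | indicator-≡ (suc j) =
    excessOf≥1 (tyAt s j) tj≢o
  ... | no x≢i | no x≢j rewrite indicator-≢ (suc i) x x≢i | indicator-≢ (suc j) x x≢j = z≤n

data Profile : List Ty → Set where
  allOrtho : ∀ L → Profile (replicate L o)
  single   : ∀ j r → Profile (oneMeta j r)
  heavy    : ∀ {s} → Heavy s → Profile s

tyAt-oneMeta : ∀ j r → tyAt (oneMeta j r) j ≡ m
tyAt-oneMeta zero    r = refl
tyAt-oneMeta (suc j) r = tyAt-oneMeta j r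

profile : ∀ s → Profile s
profile []      = allOrtho 0
profile (p ∷ s) = heavy (para 0 (s≤s z≤n) refl)
profile (o ∷ s) with profile s
... | allOrtho L = allOrtho (suc L)
... | single j r = single (suc j) r
... | heavy h    = heavy (Heavy-∷ o h)
profile (m ∷ s) with profile s
... | allOrtho L = single 0 L
... | single j r = heavy (twoNonOrtho 0 (suc j) (s≤s z≤n) (s≤s j<L) (λ ()) meta≢o)
  where
  j<L : j < length (oneMeta j r)
  j<L = subst (j <_) (sym (length-oneMeta j r)) (m<m+n j (s≤s z≤n))
  meta≢o : tyAt (oneMeta j r) j ≢ o
  meta≢o tj≡o with () ← trans (sym (tyAt-oneMeta j r)) tj≡o
... | heavy h    = heavy (Heavy-∷ m h)

excess> : ∀ b s → b < 2 * length s → (∀ j r → s ≡ oneMeta j r → b < suc j * suc r) →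
          s ≢ replicate (length s) o → b < excess s
excess> b s b<2L singles s≢ortho with profile s
... | allOrtho L = ⊥-elim (s≢ortho (cong (λ k → replicate k o) (sym (length-replicate L))))
... | single j r = subst (b <_) (sym (excess-oneMeta j r)) (singles j r refl)
... | heavy h    = <-≤-trans b<2L (Heavy⇒2L≤excess h)

private
  ≤-of-+ : ∀ x y {z} → x + y ≡ z → x ≤ z
  ≤-of-+ x y x+y≡z = subst (x ≤_) x+y≡z (m≤m+n x y)

  length-shape : ∀ {s L} j r → s ≡ oneMeta j r → length s ≡ L → j + suc r ≡ L
  length-shape j r refl |s|≡L = trans (sym (length-oneMeta j r)) |s|≡L

ortho-excess-minimum : ∀ L s → length s ≡ L → s ≢ replicate L o → excess (replicate L o) < excess s
ortho-excess-minimum L []      refl []≢[]   = ⊥-elim ([]≢[] refl)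
ortho-excess-minimum L (t ∷ s) refl s≢ortho = subst (_< excess (t ∷ s)) (sym (excess-replicate L))
  (excess> 0 (t ∷ s) (s≤s z≤n) (λ _ _ _ → s≤s z≤n) s≢ortho)

second-excess-minimum : ∀ j s → length s ≡ suc j → s ≢ replicate (suc j) o →
                        s ≢ oneMeta j 0 → s ≢ reverse (oneMeta j 0) → excess (oneMeta j 0) < excess s
second-excess-minimum j s |s|≡ s≢ortho s≢second s≢second′ =
  subst (_< excess s) (sym (trans (excess-oneMeta j 0) (*-identityʳ (suc j))))
    (excess> (suc j) s (subst (λ L → suc j < 2 * L) (sym |s|≡) (≤-of-+ (suc (suc j)) j (twice j)))
             singles (subst (λ L → s ≢ replicate L o) (sym |s|≡) s≢ortho))
  where
  twice : ∀ j → suc (suc j) + j ≡ 2 * suc j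
  twice = solve-∀
  spread : ∀ a c → suc (suc a + suc (suc c)) + (a + c + a * c) ≡ suc (suc a) * suc (suc c)
  spread = solve-∀
  singles : ∀ j′ r → s ≡ oneMeta j′ r → suc j < suc j′ * suc r
  singles j′ zero s≡ = ⊥-elim (s≢second (trans s≡ (cong (λ x → oneMeta x 0) j′≡j)))
    where
    j′≡j : j′ ≡ j
    j′≡j = suc-injective (trans (+-comm 1 j′) (length-shape j′ 0 s≡ |s|≡))
  singles zero (suc r) s≡ =
    ⊥-elim (s≢second′ (trans s≡ (trans (cong (oneMeta 0) r≡j) (sym (reverse-oneMeta j 0)))))
    where
    r≡j : suc r ≡ j
    r≡j = suc-injective (length-shape 0 (suc r) s≡ |s|≡)
  singles (suc a) (suc c) s≡ = subst (λ n → n < suc (suc a) * suc (suc c)) (length-shape (suc a) (suc c) s≡ |s|≡)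
                                     (≤-of-+ (suc (suc a + suc (suc c))) (a + c + a * c) (spread a c))

third-excess-minimum : ∀ i s → length s ≡ suc (suc i) → s ≢ replicate (suc (suc i)) o →
                       s ≢ oneMeta (suc i) 0 → s ≢ reverse (oneMeta (suc i) 0) →
                       s ≢ oneMeta i 1 → s ≢ reverse (oneMeta i 1) → excess (oneMeta i 1) < excess s
third-excess-minimum i s |s|≡ s≢ortho s≢second s≢second′ s≢third s≢third′ =
  subst (_< excess s) (sym (trans (excess-oneMeta i 1) (*-comm (suc i) 2)))
    (excess> (2 * suc i) s (subst (λ L → 2 * suc i < 2 * L) (sym |s|≡) (*-monoʳ-< 2 (n<1+n (suc i))))
             singles (subst (λ L → s ≢ replicate L o) (sym |s|≡) s≢ortho))
  where
  spread : ∀ a c → suc (2 * suc (a + suc (suc (suc c)))) + (a + c + a * c) ≡ suc (suc (suc a)) * suc (suc (suc c))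
  spread = solve-∀
  singles : ∀ j r → s ≡ oneMeta j r → 2 * suc i < suc j * suc r
  singles j zero s≡ = ⊥-elim (s≢second (trans s≡ (cong (λ x → oneMeta x 0) j≡1+i)))
    where
    j≡1+i : j ≡ suc i
    j≡1+i = suc-injective (trans (+-comm 1 j) (length-shape j 0 s≡ |s|≡))
  singles zero (suc r) s≡ =
    ⊥-elim (s≢second′ (trans s≡ (trans (cong (oneMeta 0) r≡i) (sym (reverse-oneMeta (suc i) 0)))))
    where
    r≡i : suc r ≡ suc i
    r≡i = suc-injective (length-shape 0 (suc r) s≡ |s|≡)
  singles (suc a) (suc zero) s≡ = ⊥-elim (s≢third (trans s≡ (cong (λ x → oneMeta x 1) a≡i)))
    where
    a≡i : suc a ≡ i
    a≡i = +-cancelʳ-≡ 2 (suc a) i (trans (length-shape (suc a) 1 s≡ |s|≡) (+-comm 2 i))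
  singles (suc zero) (suc (suc c)) s≡ =
    ⊥-elim (s≢third′ (trans s≡ (trans (cong (oneMeta 1) c≡i) (sym (reverse-oneMeta i 1)))))
    where
    c≡i : suc (suc c) ≡ i
    c≡i = suc-injective (suc-injective (length-shape 1 (suc (suc c)) s≡ |s|≡))
  singles (suc (suc a)) (suc (suc c)) s≡ =
    subst (λ n → 2 * suc n < suc (suc (suc a)) * suc (suc (suc c)))
          (suc-injective (suc-injective (length-shape (suc (suc a)) (suc (suc c)) s≡ |s|≡)))
          (≤-of-+ (suc (2 * suc (a + suc (suc (suc c))))) (a + c + a * c) (spread a c))

excess-ortho<second : ∀ j → excess (replicate (suc j) o) < excess (oneMeta j 0)
excess-ortho<second j rewrite excess-replicate (suc j) | excess-oneMeta j 0 = s≤s z≤n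

excess-second<third : ∀ i → 1 ≤ i → excess (oneMeta (suc i) 0) < excess (oneMeta i 1)
excess-second<third (suc k) _ rewrite excess-oneMeta (suc (suc k)) 0 | excess-oneMeta (suc k) 1 =
  ≤-of-+ (suc (suc (suc (suc k)) * 1)) k (gap k)
  where
  gap : ∀ k → suc (suc (suc (suc k)) * 1) + k ≡ suc (suc k) * 2
  gap = solve-∀

theorem2p4 : (n : ℕ) → 4 ≤ n →
      -- (i) O_n is the unique minimum
      ((s : List Ty) → length s ≡ n ∸ 2 → s ≢ orthoSeq n →
         wiener (chain (orthoSeq n)) < wiener (chain s))
    × -- (ii) the chain (o,…,o,m) is the unique second minimum
      (wiener (chain (orthoSeq n)) < wiener (chain (secondSeq n))
       × ((s : List Ty) → length s ≡ n ∸ 2 → s ≢ orthoSeq n →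
            s ≢ secondSeq n → s ≢ reverse (secondSeq n) →
            wiener (chain (secondSeq n)) < wiener (chain s)))
    × -- (iii) the chain (o,…,o,m,o) is the unique third minimum (n ≥ 5, see NOTES)
      (5 ≤ n → wiener (chain (secondSeq n)) < wiener (chain (thirdSeq n))
       × ((s : List Ty) → length s ≡ n ∸ 2 → s ≢ orthoSeq n →
            s ≢ secondSeq n → s ≢ reverse (secondSeq n) →
            s ≢ thirdSeq n → s ≢ reverse (thirdSeq n) →
            wiener (chain (thirdSeq n)) < wiener (chain s)))
theorem2p4 (suc (suc (suc (suc i)))) (s≤s (s≤s (s≤s (s≤s _)))) =
  (λ s |s| s≢ortho → wiener-< ortho s (trans |ortho| (sym |s|)) (ortho-excess-minimum L s |s| s≢ortho)) ,
  (wiener-< ortho second (trans |ortho| (sym |second|)) (excess-ortho<second (suc i)) ,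
   λ s |s| s≢ortho s≢second s≢second′ → wiener-< second s (trans |second| (sym |s|))
     (second-excess-minimum (suc i) s |s| s≢ortho s≢second s≢second′)) ,
  λ { (s≤s (s≤s (s≤s (s≤s 1≤i)))) →
    wiener-< second third (trans |second| (sym |third|)) (excess-second<third i 1≤i) ,
    λ s |s| s≢ortho s≢second s≢second′ s≢third s≢third′ → wiener-< third s (trans |third| (sym |s|))
      (third-excess-minimum i s |s| s≢ortho s≢second s≢second′ s≢third s≢third′) }
  where
  L : ℕ
  L = suc (suc i)
  ortho second third : List Ty
  ortho  = replicate L o
  second = oneMeta (suc i) 0
  third  = oneMeta i 1
  |ortho| : length ortho ≡ L
  |ortho| = length-replicate L
  |second| : length second ≡ L
  |second| = trans (length-oneMeta (suc i) 0) (+-comm (suc i) 1)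
  |third| : length third ≡ L
  |third| = trans (length-oneMeta i 1) (+-comm i 2)
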